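{- If a cube $A\in\mathcal{C}^3_3(v,k,\lambda)$ exists, then $$\lambda v(v-1)\ge k(k-v).$$ Equality holds if and only if every row-sum of $A$ is $k/v$. In that case, $(v,k,\lambda)=(v,vk',v\lambda')$ for some non-negative integers $k',\lambda'$ such that $(v,k',\lambda')$ are admissible parameters of cubes of propriety $2$, i.e. $\lambda'(v-1)=k'(k'-1)$.
   Context: A $v\times v\times v$ array is a function on $\{1,\dots,v\}^3$. A layer is a 2-dimensional subarray obtained by fixing one of the three coordinates; a row is a 1-dimensional subarray obtained by fixing two of the three coordinates (any two), and its row-sum is the sum of its $v$ entries. Two layers are parallel if they fix the same coordinate, to different values; their scalar product is the sum over all positions of the product of corresponding entries. $\mathcal{C}^3_3(v,k,\lambda)$ is the set of $v\times v\times v$ arrays over $\{0,1\}$ such that every layer (in each of the three directions) contains exactly $k$ ones and every two parallel layers have scalar product $\lambda$. (Cubes of propriety 2 with parameters $(v,k',\lambda')$ are $v\times v\times v$ arrays all of whose layers are incidence matrices of symmetric $(v,k',\lambda')$ designs; "admissible" refers to the necessary condition $\lambda'(v-1)=k'(k'-1)$ on their parameters.) -}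

module Defs where

open import Data.Fin.Base using (Fin; zero; suc; toℕ)
open import Data.Fin.Properties using (_≟_)
open import Data.Integer.Base as ℤ using (+_; 1ℤ)
open import Data.List.Base using (length; filter; cartesianProduct; allFin)
open import Data.Nat.Base using (ℕ; _*_; NonZero)
open import Data.Nat.Properties using (+-*-semiring)
open import Data.Product.Base using (_,_)
open import Data.Rational.Base as ℚ using ()
open import Relation.Binary.PropositionalEquality using (_≡_; _≢_)
open import Algebra.Properties.Semiring.Sum +-*-semiring using (sum; sum-syntax)

-- The value set {0,1} is Fin 2.
Array² : ℕ → Set
Array² v = Fin v → Fin v → Fin 2

Array³ : ℕ → Set
Array³ v = Fin v → Fin v → Fin v → Fin 2

data Coordinate : Set where
  first second third : Coordinate

-- The layer of A on which the coordinate c has the value a; the remaining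
-- two coordinates keep their order.
layer : ∀ {v} → Array³ v → Coordinate → Fin v → Array² v
layer A first  a = λ i j → A a i j
layer A second a = λ i j → A i a j
layer A third  a = λ i j → A i j a

-- The row along which the coordinate c varies, the other two being fixed, in
-- order, to i and j.
row : ∀ {v} → Array³ v → Coordinate → Fin v → Fin v → (Fin v → Fin 2)
row A first  i j = λ a → A a i j
row A second i j = λ a → A i a j
row A third  i j = λ a → A i j a

rowSum : ∀ {v} → Array³ v → Coordinate → Fin v → Fin v → ℕ
rowSum A c i j = sum (λ a → toℕ (row A c i j a))

numberOfOnes : ∀ {v} → Array² v → ℕ
numberOfOnes {v} L =
  length (filter (λ (i , j) → L i j ≟ suc zero) (cartesianProduct (allFin v) (allFin v)))

scalarProduct : ∀ {v} → Array² v → Array² v → ℕ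
scalarProduct {v} L M = ∑[ i < v ] ∑[ j < v ] (toℕ (L i j) * toℕ (M i j))

-- Membership in 𝒞³₃(v,k,λ), with λ written ℓ.  For v = 1 there are no two
-- parallel layers, so ℓ is then unconstrained.
record _∈𝒞³₃[_,_] {v : ℕ} (A : Array³ v) (k ℓ : ℕ) : Set where
  field
    layer-ones    : ∀ c a → numberOfOnes (layer A c a) ≡ k
    layer-product : ∀ c a b → a ≢ b → scalarProduct (layer A c a) (layer A c b) ≡ ℓ

-- The quotient k/v is taken in ℚ: v is not assumed to divide k.
EveryRowSumIs-k/v : ∀ {v} .{{_ : NonZero v}} → Array³ v → ℕ → Set
EveryRowSumIs-k/v {v} A k = ∀ c i j → (+ rowSum A c i j) ℚ./ 1 ≡ (+ k) ℚ./ v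

-- Subtraction is taken in ℤ, so k = 0 is treated correctly.
Admissible : ℕ → ℕ → ℕ → Set
Admissible v k ℓ = (+ ℓ) ℤ.* (+ v ℤ.- 1ℤ) ≡ (+ k) ℤ.* (+ k ℤ.- 1ℤ)

{-# OPTIONS --safe #-}
-- Fix a direction and let r range over the v² row-sums in it.  Counting ones
-- layer by layer gives Σ r = vk, and expanding the squares gives
-- Σ r² = vk + v(v − 1)λ, the sum of the scalar products of all pairs of layers.
-- Hence Σ (vr − k)² = v² (λv(v − 1) − k(k − v)), which yields the inequality and
-- its equality case.  In the latter, k = vr for any row-sum r, so that
-- λ(v − 1) = vr(r − 1), and v divides λ because it is coprime to v − 1.
module Submission where

open import Defs
open import Data.Integer.Base as ℤ using (+_; 1ℤ)
open import Data.Nat.Base using (ℕ; _*_; NonZero)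
open import Data.Product.Base using (_×_; ∃-syntax)
open import Function.Bundles using (_⇔_)
open import Relation.Binary.PropositionalEquality using (_≡_)

open import Data.Fin.Base using (Fin; zero; suc; toℕ)
open import Data.Fin.Properties using (_≟_; punchInᵢ≢i)
open import Data.List.Base using (length; filter; cartesianProduct; tabulate; map; _++_)
open import Data.List.Properties using (filter-++; length-++; map-tabulate)
open import Data.Nat.Base using (suc; _+_; _≤_; ∣_-_∣)
open import Data.Nat.Properties
  using (+-*-semiring; +-0-monoid; *-cancelˡ-≡; *-cancelˡ-≤; *-comm; *-identityʳ; *-zeroʳ;
         +-cancelʳ-≡; +-identityʳ; m*n≡0⇒m≡0∨n≡0; m+n≡0⇒m≡0; m+n≡0⇒n≡0;
         m≡n⇒∣m-n∣≡0; m≤n+m; ∣m-n∣≡0⇒m≡n)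
open import Data.Nat.Divisibility using (_∣_; divides; m∣m*n; ∣m+n∣m⇒∣n)
open import Data.Product.Base using (_,_)
import Data.Integer.Properties as ℤ
import Data.Integer.Tactic.RingSolver as ℤ-Ring
open import Data.Nat.Tactic.RingSolver using (solve-∀)
import Data.Rational.Base as ℚ
import Data.Rational.Properties as ℚ
import Data.Rational.Unnormalised.Base as ℚᵘ
import Data.Rational.Unnormalised.Properties as ℚᵘ
open import Data.Sum.Base using (reduce)
open import Function.Base using (_∘_; id)
open import Function.Bundles using (mk⇔; module Equivalence)
open import Relation.Binary.PropositionalEquality
  using (_≢_; refl; sym; trans; cong; cong₂; subst; module ≡-Reasoning)
open import Algebra.Properties.Semiring.Sum +-*-semiring
  using (sum; sum-syntax; sum-cong-≗; sum-replicate; sum-remove; ∑-distrib-+; ∑-comm;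
         *-distribˡ-sum; *-distribʳ-sum)
import Algebra.Properties.AbelianGroup ℤ.+-0-abelianGroup as ℤGroup
import Algebra.Properties.Monoid.Mult +-0-monoid as Mult

open ≡-Reasoning

-- Finite sums and squares in ℕ.

∑-const : ∀ n {f : Fin n → ℕ} {c} → (∀ i → f i ≡ c) → sum f ≡ n * c
∑-const n {c = c} f≡c = trans (sum-cong-≗ f≡c) (trans (sum-replicate n) (×≡* n))
  where
  ×≡* : ∀ n → n Mult.× c ≡ n * c
  ×≡* ℕ.zero  = refl
  ×≡* (suc n) = cong (λ x → c + x) (×≡* n)

∑-cong₂ : ∀ {m n} {f g : Fin m → Fin n → ℕ} → (∀ i j → f i j ≡ g i j) →
          ∑[ i < m ] ∑[ j < n ] f i j ≡ ∑[ i < m ] ∑[ j < n ] g i j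
∑-cong₂ f≡g = sum-cong-≗ (sum-cong-≗ ∘ f≡g)

∑₂-distrib-+ : ∀ {m n} (f g : Fin m → Fin n → ℕ) →
               ∑[ i < m ] ∑[ j < n ] (f i j + g i j) ≡
               ∑[ i < m ] ∑[ j < n ] f i j + ∑[ i < m ] ∑[ j < n ] g i j
∑₂-distrib-+ f g = trans (sum-cong-≗ λ i → ∑-distrib-+ (f i) (g i)) (∑-distrib-+ (sum ∘ f) (sum ∘ g))

*-distribˡ-∑₂ : ∀ {m n} c (f : Fin m → Fin n → ℕ) →
                c * ∑[ i < m ] ∑[ j < n ] f i j ≡ ∑[ i < m ] ∑[ j < n ] (c * f i j)
*-distribˡ-∑₂ c f = trans (*-distribˡ-sum c (sum ∘ f)) (sum-cong-≗ λ i → *-distribˡ-sum c (f i))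

∑₂-comm : ∀ {l m n} (f : Fin l → Fin m → Fin n → ℕ) →
          ∑[ i < m ] ∑[ j < n ] ∑[ a < l ] f a i j ≡ ∑[ a < l ] ∑[ i < m ] ∑[ j < n ] f a i j
∑₂-comm {l} {m} {n} f = trans (sum-cong-≗ λ i → ∑-comm λ j a → f a i j)
                              (∑-comm λ i a → ∑[ j < n ] f a i j)

sum-* : ∀ {m n} (f : Fin m → ℕ) (g : Fin n → ℕ) → sum f * sum g ≡ ∑[ a < m ] ∑[ b < n ] (f a * g b)
sum-* f g = trans (*-distribʳ-sum (sum g) f) (sum-cong-≗ λ a → *-distribˡ-sum (f a) g)

sum≡0⇒≡0 : ∀ {n} (f : Fin n → ℕ) → sum f ≡ 0 → ∀ i → f i ≡ 0
sum≡0⇒≡0 f eq zero    = m+n≡0⇒m≡0 (f zero) eq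
sum≡0⇒≡0 f eq (suc i) = sum≡0⇒≡0 (f ∘ suc) (m+n≡0⇒n≡0 (f zero) eq) i

-- Serves to sum one line of the Gram matrix of the parallel layers: one diagonal entry `x` and `n`
-- entries `y`.
∑-almost-const : ∀ n {f : Fin (suc n) → ℕ} {x y} i → f i ≡ x → (∀ j → i ≢ j → f j ≡ y) →
                 sum f ≡ x + n * y
∑-almost-const n {f} i fi≡x fj≡y =
  trans (sum-remove {i = i} f) (cong₂ _+_ fi≡x (∑-const n λ j → fj≡y _ (punchInᵢ≢i i j ∘ sym)))

-- The binomial formula for (m - n)², with the cross term moved to the left so that it holds in ℕ
-- whichever of `m` and `n` is larger. Lowering both by one leaves the distance unchanged, which
-- drives the induction.
∣m-n∣²+2mn : ∀ m n → ∣ m - n ∣ * ∣ m - n ∣ + 2 * (m * n) ≡ m * m + n * n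
∣m-n∣²+2mn ℕ.zero  n       = +-identityʳ (n * n)
∣m-n∣²+2mn (suc m) ℕ.zero  = cong (λ x → suc m * suc m + 2 * x) (*-zeroʳ m)
∣m-n∣²+2mn (suc m) (suc n) = begin
  d * d + 2 * (suc m * suc n)              ≡⟨ expand (d * d) m n ⟩
  (d * d + 2 * (m * n)) + 2 * (m + n + 1)  ≡⟨ cong (_+ 2 * (m + n + 1)) (∣m-n∣²+2mn m n) ⟩
  (m * m + n * n) + 2 * (m + n + 1)        ≡⟨ collect m n ⟩
  suc m * suc m + suc n * suc n            ∎
  where
  d = ∣ m - n ∣
  expand : ∀ e m n → e + 2 * (suc m * suc n) ≡ (e + 2 * (m * n)) + 2 * (m + n + 1)
  expand = solve-∀
  collect : ∀ m n → (m * m + n * n) + 2 * (m + n + 1) ≡ suc m * suc m + suc n * suc n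
  collect = solve-∀

-- Counting ones by sums.

count-tabulate : ∀ {a} {X : Set a} (χ : X → Fin 2) {n} (f : Fin n → X) →
                 length (filter (λ x → χ x ≟ suc zero) (tabulate f)) ≡ ∑[ i < n ] toℕ (χ (f i))
count-tabulate χ {ℕ.zero} f = refl
count-tabulate χ {suc n}  f with χ (f zero)
... | zero     = count-tabulate χ (f ∘ suc)
... | suc zero = cong suc (count-tabulate χ (f ∘ suc))

-- The induction on `m` replaces `f` by `f ∘ suc`, so `f` and `g` are arbitrary; `allFin` is the
-- case of `id`.
count-cartesianProduct :
  ∀ {a b} {X : Set a} {Y : Set b} (χ : X × Y → Fin 2) {m n} (f : Fin m → X) (g : Fin n → Y) →
  length (filter (λ x → χ x ≟ suc zero) (cartesianProduct (tabulate f) (tabulate g))) ≡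
  ∑[ i < m ] ∑[ j < n ] toℕ (χ (f i , g j))
count-cartesianProduct χ {ℕ.zero} f g = refl
count-cartesianProduct χ {suc m}  f g = begin
  length (filter χ? (map (f zero ,_) (tabulate g) ++ rest))
    ≡⟨ cong length (filter-++ χ? (map (f zero ,_) (tabulate g)) rest) ⟩
  length (filter χ? (map (f zero ,_) (tabulate g)) ++ filter χ? rest)
    ≡⟨ length-++ (filter χ? (map (f zero ,_) (tabulate g))) ⟩
  length (filter χ? (map (f zero ,_) (tabulate g))) + length (filter χ? rest)
    ≡⟨ cong₂ _+_
         (trans (cong (length ∘ filter χ?) (map-tabulate g (f zero ,_)))
                (count-tabulate χ ((f zero ,_) ∘ g)))
         (count-cartesianProduct χ (f ∘ suc) g) ⟩
  sum (λ i → sum (λ j → toℕ (χ (f i , g j)))) ∎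
  where
  χ? = λ x → χ x ≟ suc zero
  rest = cartesianProduct (tabulate (f ∘ suc)) (tabulate g)

numberOfOnes≡∑ : ∀ {v} (L : Array² v) → numberOfOnes L ≡ ∑[ i < v ] ∑[ j < v ] toℕ (L i j)
numberOfOnes≡∑ L = count-cartesianProduct (λ (i , j) → L i j) id id

-- Entries 0 and 1 equal their own squares. This supplies the diagonal of the Gram matrix.
scalarProduct-self : ∀ {v} (L : Array² v) → scalarProduct L L ≡ numberOfOnes L
scalarProduct-self L = trans (∑-cong₂ λ i j → idem (L i j)) (sym (numberOfOnes≡∑ L))
  where
  idem : ∀ (x : Fin 2) → toℕ x * toℕ x ≡ toℕ x
  idem zero       = refl
  idem (suc zero) = refl

-- Sums of the row-sums and of their squares.

-- `row` and `layer` compute only once the coordinate is known. After this case split the three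
-- directions are treated uniformly.
rowSum≡∑-layer : ∀ {v} (A : Array³ v) c i j → rowSum A c i j ≡ ∑[ a < v ] toℕ (layer A c a i j)
rowSum≡∑-layer A first  i j = refl
rowSum≡∑-layer A second i j = refl
rowSum≡∑-layer A third  i j = refl

∑-rowSum : ∀ {v} (A : Array³ v) c →
           ∑[ i < v ] ∑[ j < v ] rowSum A c i j ≡ ∑[ a < v ] numberOfOnes (layer A c a)
∑-rowSum {v} A c = begin
  ∑[ i < v ] ∑[ j < v ] rowSum A c i j
    ≡⟨ ∑-cong₂ (rowSum≡∑-layer A c) ⟩
  ∑[ i < v ] ∑[ j < v ] ∑[ a < v ] toℕ (layer A c a i j)
    ≡⟨ ∑₂-comm (λ a i j → toℕ (layer A c a i j)) ⟩
  ∑[ a < v ] ∑[ i < v ] ∑[ j < v ] toℕ (layer A c a i j)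
    ≡⟨ sum-cong-≗ (λ a → numberOfOnes≡∑ (layer A c a)) ⟨
  ∑[ a < v ] numberOfOnes (layer A c a) ∎

-- The square of a row-sum is a double sum over pairs of layers `a`, `b`. Exchanging summations
-- collects, for each pair, the products at all positions `i`, `j`.
∑-rowSum² : ∀ {v} (A : Array³ v) c →
            ∑[ i < v ] ∑[ j < v ] (rowSum A c i j * rowSum A c i j) ≡
            ∑[ a < v ] ∑[ b < v ] scalarProduct (layer A c a) (layer A c b)
∑-rowSum² {v} A c = begin
  ∑[ i < v ] ∑[ j < v ] (rowSum A c i j * rowSum A c i j)
    ≡⟨ ∑-cong₂ (λ i j → trans (cong (λ r → r * r) (rowSum≡∑-layer A c i j))
                              (sum-* (λ a → t a i j) (λ b → t b i j))) ⟩
  ∑[ i < v ] ∑[ j < v ] ∑[ a < v ] ∑[ b < v ] (t a i j * t b i j)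
    ≡⟨ ∑₂-comm (λ a i j → ∑[ b < v ] (t a i j * t b i j)) ⟩
  ∑[ a < v ] ∑[ i < v ] ∑[ j < v ] ∑[ b < v ] (t a i j * t b i j)
    ≡⟨ sum-cong-≗ (λ a → ∑₂-comm (λ b i j → t a i j * t b i j)) ⟩
  ∑[ a < v ] ∑[ b < v ] scalarProduct (layer A c a) (layer A c b) ∎
  where
  t : Fin v → Fin v → Fin v → ℕ
  t a i j = toℕ (layer A c a i j)

-- This is v² times the squared deviation of the row-sum from k/v; the scaling and the absolute
-- difference keep it in ℕ.
squaredDeviation : ∀ {v} → Array³ v → ℕ → Coordinate → Fin v → Fin v → ℕ
squaredDeviation {v} A k c i j = ∣ v * rowSum A c i j - k ∣ * ∣ v * rowSum A c i j - k ∣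

-- The inequality and its equality case over ℕ.

module _ {n k ℓ} {A : Array³ (suc n)} (A∈𝒞 : A ∈𝒞³₃[ k , ℓ ]) where
  open _∈𝒞³₃[_,_] A∈𝒞

  private
    v = suc n

  ∑-rowSum≡vk : ∀ c → ∑[ i < v ] ∑[ j < v ] rowSum A c i j ≡ v * k
  ∑-rowSum≡vk c = trans (∑-rowSum A c) (∑-const v (layer-ones c))

  ∑-rowSum²≡v[k+nℓ] : ∀ c → ∑[ i < v ] ∑[ j < v ] (rowSum A c i j * rowSum A c i j) ≡ v * (k + n * ℓ)
  ∑-rowSum²≡v[k+nℓ] c = trans (∑-rowSum² A c) (∑-const v λ a →
    ∑-almost-const n a (trans (scalarProduct-self (layer A c a)) (layer-ones c a)) (layer-product c a))

  -- With n = v − 1, comparing ℓvn + kv with k² avoids the subtraction in k(k − v).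
  ∑-squaredDeviation : ∀ c → ∑[ i < v ] ∑[ j < v ] squaredDeviation A k c i j + v * v * (k * k) ≡
                             v * v * (ℓ * v * n + k * v)
  -- A second copy of v²k² is added: the two copies make 2vk · vk, where the last vk is the sum of
  -- all row-sums. This restores the cross terms, and each square can be expanded.
  ∑-squaredDeviation c = +-cancelʳ-≡ (v * v * (k * k)) _ _ (begin
    S + v * v * (k * k) + v * v * (k * k)
      ≡⟨ regroup S v k ⟩
    S + 2 * v * k * (v * k)
      ≡⟨ cong (λ x → S + 2 * v * k * x) (∑-rowSum≡vk c) ⟨
    S + 2 * v * k * ∑[ i < v ] ∑[ j < v ] r i j
      ≡⟨ cong (λ x → S + x) (*-distribˡ-∑₂ (2 * v * k) r) ⟩
    S + ∑[ i < v ] ∑[ j < v ] (2 * v * k * r i j)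
      ≡⟨ ∑₂-distrib-+ (squaredDeviation A k c) (λ i j → 2 * v * k * r i j) ⟨
    ∑[ i < v ] ∑[ j < v ] (squaredDeviation A k c i j + 2 * v * k * r i j)
      ≡⟨ ∑-cong₂ (λ i j → square v k (r i j)) ⟩
    ∑[ i < v ] ∑[ j < v ] (v * v * (r i j * r i j) + k * k)
      ≡⟨ ∑₂-distrib-+ (λ i j → v * v * (r i j * r i j)) (λ _ _ → k * k) ⟩
    ∑[ i < v ] ∑[ j < v ] (v * v * (r i j * r i j)) + ∑[ i < v ] ∑[ j < v ] (k * k)
      ≡⟨ cong₂ _+_
           (trans (sym (*-distribˡ-∑₂ (v * v) λ i j → r i j * r i j))
                  (cong (v * v *_) (∑-rowSum²≡v[k+nℓ] c)))
           (∑-const v λ _ → ∑-const v λ _ → refl) ⟩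
    v * v * (v * (k + n * ℓ)) + v * (v * (k * k))
      ≡⟨ collect v k n ℓ ⟩
    v * v * (ℓ * v * n + k * v) + v * v * (k * k) ∎)
    where
    r = rowSum A c
    S = ∑[ i < v ] ∑[ j < v ] squaredDeviation A k c i j

    regroup : ∀ S v k → S + v * v * (k * k) + v * v * (k * k) ≡ S + 2 * v * k * (v * k)
    regroup = solve-∀

    square : ∀ v k r → ∣ v * r - k ∣ * ∣ v * r - k ∣ + 2 * v * k * r ≡ v * v * (r * r) + k * k
    square v k r = trans (cong (λ x → ∣ v * r - k ∣ * ∣ v * r - k ∣ + x) (cross v k r))
                         (trans (∣m-n∣²+2mn (v * r) k) (cong (_+ k * k) (squares v r)))
      where
      cross : ∀ v k r → 2 * v * k * r ≡ 2 * (v * r * k)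
      cross = solve-∀
      squares : ∀ v r → v * r * (v * r) ≡ v * v * (r * r)
      squares = solve-∀

    collect : ∀ v k n ℓ → v * v * (v * (k + n * ℓ)) + v * (v * (k * k)) ≡
                          v * v * (ℓ * v * n + k * v) + v * v * (k * k)
    collect = solve-∀

  k²≤ℓvn+kv : k * k ≤ ℓ * v * n + k * v
  -- The sum of the squared deviations is a natural number, so dropping it from the identity leaves
  -- an inequality.
  k²≤ℓvn+kv = *-cancelˡ-≤ (v * v) (subst (v * v * (k * k) ≤_) (∑-squaredDeviation first)
    (m≤n+m _ (∑[ i < v ] ∑[ j < v ] squaredDeviation A k first i j)))

  -- Equality makes the sum of squares vanish in each direction `c`, hence every single square
  -- vanishes.
  equality⇒v*rowSum≡k : ℓ * v * n + k * v ≡ k * k → ∀ c i j → v * rowSum A c i j ≡ k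
  equality⇒v*rowSum≡k eq c i j = ∣m-n∣≡0⇒m≡n (reduce (m*n≡0⇒m≡0∨n≡0 _ (deviation≡0 i j)))
    where
    S≡0 : ∑[ i < v ] ∑[ j < v ] squaredDeviation A k c i j ≡ 0
    S≡0 = +-cancelʳ-≡ (v * v * (k * k)) _ 0 (trans (∑-squaredDeviation c) (cong (v * v *_) eq))
    deviation≡0 : ∀ i j → squaredDeviation A k c i j ≡ 0
    deviation≡0 i = sum≡0⇒≡0 (squaredDeviation A k c i) (sum≡0⇒≡0 (sum ∘ squaredDeviation A k c) S≡0 i)

  v*rowSum≡k⇒equality : ∀ c → (∀ i j → v * rowSum A c i j ≡ k) → ℓ * v * n + k * v ≡ k * k
  v*rowSum≡k⇒equality c vr≡k = *-cancelˡ-≡ _ _ (v * v) (trans (sym (∑-squaredDeviation c))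
    (cong (_+ v * v * (k * k)) S≡0))
    where
    deviation≡0 : ∀ i j → squaredDeviation A k c i j ≡ 0
    deviation≡0 i j = cong (λ d → d * d) (m≡n⇒∣m-n∣≡0 (vr≡k i j))
    S≡0 : ∑[ i < v ] ∑[ j < v ] squaredDeviation A k c i j ≡ 0
    S≡0 = trans (∑-cong₂ deviation≡0)
      (trans (∑-const v λ _ → trans (∑-const v λ _ → refl) (*-zeroʳ v)) (*-zeroʳ v))

-- Divisibility of the parameters in the equality case.

-- Putting k = vr and cancelling one `v` leaves ℓn + vr = vr². Once `v` is known to divide `ℓ`, a
-- further factor cancels, giving ℓ'(v - 1) = r(r - 1) in a form without subtraction.
equality-divisible : ∀ n {k ℓ} r → let v = suc n in
                     v * r ≡ k → ℓ * v * n + k * v ≡ k * k →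
                     ∃[ ℓ' ] (ℓ ≡ v * ℓ' × ℓ' * n + r ≡ r * r)
equality-divisible n {ℓ = ℓ} r refl eq with v∣ℓ
  where
  v = suc n
  reduced : ℓ * n + v * r ≡ v * (r * r)
  reduced = *-cancelˡ-≡ _ _ v (trans (factor v n ℓ r) (trans eq (squares v r)))
    where
    factor : ∀ v n ℓ r → v * (ℓ * n + v * r) ≡ ℓ * v * n + v * r * v
    factor = solve-∀
    squares : ∀ v r → v * r * (v * r) ≡ v * (v * (r * r))
    squares = solve-∀
  v∣ℓ : v ∣ ℓ
  -- The coprimality of `v` and n = v - 1 is made explicit: adding `ℓ` to both sides turns ℓn into
  -- ℓv, so `ℓ` is a difference of two multiples of `v`.
  v∣ℓ = ∣m+n∣m⇒∣n (subst (v ∣_) total (m∣m*n (ℓ + r))) (m∣m*n (r * r))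
    where
    expand : ∀ n ℓ r → suc n * (ℓ + r) ≡ ℓ * n + suc n * r + ℓ
    expand = solve-∀
    total : v * (ℓ + r) ≡ v * (r * r) + ℓ
    total = trans (expand n ℓ r) (cong (_+ ℓ) reduced)
-- With ℓ = ℓ'v, every term of the original equality contains v².
... | divides ℓ' refl = ℓ' , *-comm ℓ' (suc n) , *-cancelˡ-≡ _ _ (suc n * suc n)
        (trans (factor (suc n) n ℓ' r) (trans eq (squares (suc n) r)))
  where
  factor : ∀ v n ℓ' r → v * v * (ℓ' * n + r) ≡ ℓ' * v * v * n + v * r * v
  factor = solve-∀
  squares : ∀ v r → v * r * (v * r) ≡ v * v * (r * r)
  squares = solve-∀

-- Passage from ℕ to ℤ and ℚ.

pos-+-cancelʳ : ∀ a b → + a ≡ + (a + b) ℤ.- + b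
pos-+-cancelʳ a b = cancel (+ a) (+ b)
  where
  cancel : ∀ x y → x ≡ x ℤ.+ y ℤ.- y
  cancel = ℤ-Ring.solve-∀

pos-*-distribˡ-- : ∀ k m n → + k ℤ.* (+ m ℤ.- + n) ≡ + (k * m) ℤ.- + (k * n)
pos-*-distribˡ-- k m n = trans (distrib (+ k) (+ m) (+ n))
  (sym (cong₂ ℤ._-_ (ℤ.pos-* k m) (ℤ.pos-* k n)))
  where
  distrib : ∀ x y z → x ℤ.* (y ℤ.- z) ≡ x ℤ.* y ℤ.- x ℤ.* z
  distrib = ℤ-Ring.solve-∀

a≥k[k-v] : ∀ {a} k v → k * k ≤ a + k * v → + a ℤ.≥ + k ℤ.* (+ k ℤ.- + v)
a≥k[k-v] {a} k v k²≤a+kv = ℤ.≤-trans (ℤ.≤-reflexive (pos-*-distribˡ-- k k v))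
  (ℤ.≤-trans (ℤ.+-monoˡ-≤ (ℤ.- (+ (k * v))) (ℤ.+≤+ k²≤a+kv))
             (ℤ.≤-reflexive (sym (pos-+-cancelʳ a (k * v)))))

a≡k[k-v] : ∀ {a} k v → (+ a ≡ + k ℤ.* (+ k ℤ.- + v)) ⇔ (a + k * v ≡ k * k)
a≡k[k-v] {a} k v = mk⇔
  (λ eq → ℤ.+-injective (ℤGroup.∙-cancelʳ (ℤ.- (+ (k * v))) _ _
    (trans (sym (pos-+-cancelʳ a (k * v))) (trans eq (pos-*-distribˡ-- k k v)))))
  (λ eq → trans (pos-+-cancelʳ a (k * v))
    (trans (cong (λ x → + x ℤ.- + (k * v)) eq) (sym (pos-*-distribˡ-- k k v))))

-- Cross-multiplication, carried out on unnormalised fractions because normalised ones do not expose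
-- the given numerator and denominator.
r/1≡k/v : ∀ n {r k} → ((+ r) ℚ./ 1 ≡ (+ k) ℚ./ suc n) ⇔ (suc n * r ≡ k)
r/1≡k/v n {r} {k} = mk⇔
  (λ eq → ℤ.+-injective (trans (sym rv≡vr)
    (trans (ℚᵘ.drop-*≡* (ℚ./-injective-≃ r/1 k/v eq)) (ℤ.*-identityʳ (+ k)))))
  (λ eq → ℚ.fromℚᵘ-cong {r/1} {k/v} (ℚᵘ.*≡*
    (trans rv≡vr (trans (cong +_ eq) (sym (ℤ.*-identityʳ (+ k)))))))
  where
  -- The second argument of `mkℚᵘ` is the denominator minus one.
  r/1 = ℚᵘ.mkℚᵘ (+ r) 0
  k/v = ℚᵘ.mkℚᵘ (+ k) n
  rv≡vr : + r ℤ.* + suc n ≡ + (suc n * r)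
  rv≡vr = trans (ℤ.*-comm (+ r) (+ suc n)) (sym (ℤ.pos-* (suc n) r))

proposition2p1 : ∀ (v k ℓ : ℕ) .{{_ : NonZero v}} (A : Array³ v) → A ∈𝒞³₃[ k , ℓ ] →
    ((+ ℓ) ℤ.* (+ v) ℤ.* (+ v ℤ.- 1ℤ) ℤ.≥ (+ k) ℤ.* (+ k ℤ.- + v))
    × (((+ ℓ) ℤ.* (+ v) ℤ.* (+ v ℤ.- 1ℤ) ≡ (+ k) ℤ.* (+ k ℤ.- + v)) ⇔ EveryRowSumIs-k/v A k)
    × ((+ ℓ) ℤ.* (+ v) ℤ.* (+ v ℤ.- 1ℤ) ≡ (+ k) ℤ.* (+ k ℤ.- + v) →
    ∃[ k' ] ∃[ ℓ' ] (k ≡ v * k' × ℓ ≡ v * ℓ' × Admissible v k' ℓ'))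
proposition2p1 v@(suc n) k ℓ A A∈𝒞 =
    subst (ℤ._≥ (+ k) ℤ.* (+ k ℤ.- + v)) (sym lhs) (a≥k[k-v] k v (k²≤ℓvn+kv A∈𝒞))
  , mk⇔
      (λ eq c i j → from (r/1≡k/v n) (equality⇒v*rowSum≡k A∈𝒞 (ℕ-equality eq) c i j))
      (λ r≡k/v → trans lhs (from (a≡k[k-v] k v)
        (v*rowSum≡k⇒equality A∈𝒞 first λ i j → to (r/1≡k/v n) (r≡k/v first i j))))
  , divisibility
  where
  open Equivalence

  lhs : (+ ℓ) ℤ.* (+ v) ℤ.* (+ v ℤ.- 1ℤ) ≡ + (ℓ * v * n)
  -- Since `v` is `suc n`, the factor `+ v ℤ.- 1ℤ` computes to `+ n`.
  lhs = trans (cong (ℤ._* (+ n)) (sym (ℤ.pos-* ℓ v))) (sym (ℤ.pos-* (ℓ * v) n))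

  ℕ-equality : (+ ℓ) ℤ.* (+ v) ℤ.* (+ v ℤ.- 1ℤ) ≡ (+ k) ℤ.* (+ k ℤ.- + v) →
               ℓ * v * n + k * v ≡ k * k
  ℕ-equality eq = to (a≡k[k-v] k v) (trans (sym lhs) eq)

  divisibility : (+ ℓ) ℤ.* (+ v) ℤ.* (+ v ℤ.- 1ℤ) ≡ (+ k) ℤ.* (+ k ℤ.- + v) →
                 ∃[ k' ] ∃[ ℓ' ] (k ≡ v * k' × ℓ ≡ v * ℓ' × Admissible v k' ℓ')
  divisibility eq =
    -- The witness k' is the row-sum k/v, read off at a position that exists because `v` is
    -- positive.
    let r                      = rowSum A first zero zero
        vr≡k                   = equality⇒v*rowSum≡k A∈𝒞 (ℕ-equality eq) first zero zero
        ℓ' , ℓ≡vℓ' , ℓ'n+r≡r² = equality-divisible n r vr≡k (ℕ-equality eq)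
    in r , ℓ' , sym vr≡k , ℓ≡vℓ' ,
       trans (sym (ℤ.pos-* ℓ' n))
             -- Taking 1 for `v` in `a≡k[k-v]` produces the product r(r - 1) of admissibility.
             (from (a≡k[k-v] r 1) (trans (cong (λ x → ℓ' * n + x) (*-identityʳ r)) ℓ'n+r≡r²))
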